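{- Let $k\ge 1$ be an integer. If $G$ is a graph of order $n$, then $L_k(G)\leq n+k-1-\Delta(G)$.
   Context: All graphs are finite, undirected, simple and nontrivial (at least two vertices). $\Delta(G)$ is the maximum degree and $N[v]=\{v\}\cup N(v)$ is the closed neighbourhood of $v$. For an integer $k\ge 1$, a set $B\subseteq V(G)$ is a $k$-limited packing if $|N[v]\cap B|\le k$ for every vertex $v$ of $G$; $L_k(G)$ is the maximum cardinality of a $k$-limited packing in $G$. -}

module Defs where

open import Data.Bool.Base using (true; false)
open import Data.Fin.Base using (Fin)
open import Data.Fin.Properties using (all?)
open import Data.Fin.Subset using (Subset; inside; outside; ⊥; ⁅_⁆; _∪_; _∩_; ∣_∣)
open import Data.Fin.Subset.Properties using (∣⊥∣≡0; ∩-zeroʳ)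
open import Data.List.Base using (List; []; _∷_; _++_; map; filter; allFin)
open import Data.List.Extrema.Nat using (max)
open import Data.List.Membership.Propositional using (_∈_)
open import Data.List.Membership.Propositional.Properties using (∈-map⁺; ∈-++⁺ˡ; ∈-++⁺ʳ)
open import Data.List.Relation.Unary.Any using (here)
open import Data.Nat.Base using (ℕ; zero; suc; _≤_; z≤n)
open import Data.Nat.Properties using (_≤?_)
open import Data.Vec.Base using ([]; _∷_; tabulate)
open import Level using (0ℓ)
open import Relation.Binary.Core using (Rel)
open import Relation.Binary.Definitions using (Decidable; Irreflexive; Symmetric)
open import Relation.Binary.PropositionalEquality using (_≡_; refl; sym; trans; cong; subst)
open import Relation.Nullary.Decidable using (Dec; does)

-- A finite simple graph of order n, with its vertices labelled by Fin n.
-- Decidability of adjacency makes neighbourhoods finite subsets and is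
-- automatic classically.
record Graph (n : ℕ) : Set₁ where
  field
    Adj    : Rel (Fin n) 0ℓ
    adj?   : Decidable Adj
    symm   : Symmetric Adj
    irrefl : Irreflexive _≡_ Adj

module _ {n : ℕ} (G : Graph n) where
  open Graph G

  N : Fin n → Subset n
  N v = tabulate (λ u → does (adj? v u))

  N[_] : Fin n → Subset n
  N[ v ] = ⁅ v ⁆ ∪ N v

  degree : Fin n → ℕ
  degree v = ∣ N v ∣

  -- The base value 0 matters only when n is 0.
  Δ : ℕ
  Δ = max 0 (map degree (allFin n))

  IsLimitedPacking : ℕ → Subset n → Set
  IsLimitedPacking k B = ∀ v → ∣ N[ v ] ∩ B ∣ ≤ k

  isLimitedPacking? : ∀ k B → Dec (IsLimitedPacking k B)
  isLimitedPacking? k B = all? (λ v → ∣ N[ v ] ∩ B ∣ ≤? k)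

  ⊥-isLimitedPacking : ∀ k → IsLimitedPacking k ⊥
  ⊥-isLimitedPacking k v =
    subst (_≤ k) (sym (trans (cong ∣_∣ (∩-zeroʳ N[ v ])) (∣⊥∣≡0 n))) z≤n

subsets : ∀ n → List (Subset n)
subsets zero    = [] ∷ []
subsets (suc n) = map (inside ∷_) (subsets n) ++ map (outside ∷_) (subsets n)

∈-subsets : ∀ {n} (B : Subset n) → B ∈ subsets n
∈-subsets []                  = here refl
∈-subsets (true  ∷ B)         = ∈-++⁺ˡ (∈-map⁺ (inside ∷_) (∈-subsets B))
∈-subsets {suc n} (false ∷ B) =
  ∈-++⁺ʳ (map (inside ∷_) (subsets n)) (∈-map⁺ (outside ∷_) (∈-subsets B))

-- The maximum cardinality of a k-limited packing. The base value 0 is the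
-- cardinality of the empty set, which is always a k-limited packing.
L : ∀ {n} → ℕ → Graph n → ℕ
L {n} k G = max 0 (map ∣_∣ (filter (isLimitedPacking? G k) (subsets n)))

{-# OPTIONS --safe #-}
-- For a k-limited packing B and a vertex v, inclusion–exclusion gives
-- |B| + |N[v]| = |N[v] ∪ B| + |N[v] ∩ B| ≤ n + k, and |N[v]| ≥ deg v + 1.
-- Taking v of maximum degree and B of maximum size yields L_k + Δ + 1 ≤ n + k.
module Submission where

open import Defs
open import Data.Fin.Subset using (Subset; inside; outside; ⁅_⁆; _∪_; _∩_; ∣_∣; _∉_)
  renaming (⊥ to ∅)
open import Data.Fin.Subset.Properties
  using (∣p∣≤n; p⊂q⇒∣p∣<∣q∣; p⊆p∪q; q⊆p∪q; x∈⁅x⁆)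
open import Data.List.Base using (allFin)
open import Data.List.Extrema.Nat using (argmax-all)
import Data.List.Relation.Unary.All as All
open import Data.List.Relation.Unary.All.Properties using (map⁺; all-filter)
open import Data.Nat.Base as ℕ using (ℕ; suc; _≤_)
import Data.Nat.Properties as ℕ
open import Data.Integer.Base as ℤ using (+_; _+_; _-_)
import Data.Integer.Properties as ℤ
open import Data.Integer.Tactic.RingSolver using (solve-∀)
open import Data.Product.Base using (_,_)
open import Data.Vec.Base using ([]; _∷_)
open import Data.Vec.Properties using (lookup∘tabulate; []=⇒lookup)
open import Function.Base using (id)
open import Relation.Binary.PropositionalEquality
  using (_≡_; refl; sym; trans; cong; subst)
open import Relation.Nullary.Decidable using (dec-false)

-- Each position adds the same amount to both sides: 0 if it lies in neither set, 1 if in exactly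
-- one, 2 if in both. `ℕ.+-suc` pulls out the unit that sits in a second summand.
∣p∣+∣q∣≡∣p∪q∣+∣p∩q∣ : ∀ {n} (p q : Subset n) →
  ∣ p ∣ ℕ.+ ∣ q ∣ ≡ ∣ p ∪ q ∣ ℕ.+ ∣ p ∩ q ∣
∣p∣+∣q∣≡∣p∪q∣+∣p∩q∣ []            []            = refl
∣p∣+∣q∣≡∣p∪q∣+∣p∩q∣ (outside ∷ p) (outside ∷ q) = ∣p∣+∣q∣≡∣p∪q∣+∣p∩q∣ p q
∣p∣+∣q∣≡∣p∪q∣+∣p∩q∣ (inside  ∷ p) (outside ∷ q) = cong suc (∣p∣+∣q∣≡∣p∪q∣+∣p∩q∣ p q)
∣p∣+∣q∣≡∣p∪q∣+∣p∩q∣ (outside ∷ p) (inside  ∷ q) =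
  trans (ℕ.+-suc ∣ p ∣ ∣ q ∣) (cong suc (∣p∣+∣q∣≡∣p∪q∣+∣p∩q∣ p q))
∣p∣+∣q∣≡∣p∪q∣+∣p∩q∣ (inside  ∷ p) (inside  ∷ q) = cong suc
  (trans (ℕ.+-suc ∣ p ∣ ∣ q ∣)
    (trans (cong suc (∣p∣+∣q∣≡∣p∪q∣+∣p∩q∣ p q)) (sym (ℕ.+-suc ∣ p ∪ q ∣ ∣ p ∩ q ∣))))

m+[1+n]≤o⇒m≤o-1-n : ∀ {m n o} → m ℕ.+ suc n ≤ o → + m ℤ.≤ + o - + 1 - + n
m+[1+n]≤o⇒m≤o-1-n {m} {n} h =
  -- Write `+ m` as `+ m + (+ 1 + + n) - + 1 - + n`; the sum before the subtractions computes to
  -- `+ (m ℕ.+ suc n)`, so the hypothesis applies.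
  subst (ℤ._≤ _) (sym (cancel (+ m) (+ n)))
    (ℤ.+-monoˡ-≤ (ℤ.- + n) (ℤ.+-monoˡ-≤ (ℤ.- + 1) (ℤ.+≤+ h)))
  where
  cancel : ∀ i j → i ≡ i + (+ 1 + j) - + 1 - j
  cancel = solve-∀

module _ {n} (G : Graph n) where
  open Graph G

  v∉N : ∀ v → v ∉ N G v
  v∉N v v∈N
    with () ← trans (sym ([]=⇒lookup v∈N))
                (trans (lookup∘tabulate _ v) (dec-false (adj? v v) (irrefl refl)))

  degree<∣N[v]∣ : ∀ v → suc (degree G v) ≤ ∣ N[_] G v ∣
  degree<∣N[v]∣ v = p⊂q⇒∣p∣<∣q∣
    -- The vertex `v` itself witnesses that the inclusion is strict.
    (q⊆p∪q ⁅ v ⁆ (N G v) , v , p⊆p∪q (N G v) (x∈⁅x⁆ v) , v∉N v)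

  packing+degree≤ : ∀ {k B} → IsLimitedPacking G k B →
    ∀ v → ∣ B ∣ ℕ.+ suc (degree G v) ≤ n ℕ.+ k
  packing+degree≤ {k} {B} packing v = begin
    ∣ B ∣ ℕ.+ suc (degree G v)                   ≤⟨ ℕ.+-monoʳ-≤ ∣ B ∣ (degree<∣N[v]∣ v) ⟩
    ∣ B ∣ ℕ.+ ∣ N[_] G v ∣                       ≡⟨ ℕ.+-comm ∣ B ∣ _ ⟩
    ∣ N[_] G v ∣ ℕ.+ ∣ B ∣                       ≡⟨ ∣p∣+∣q∣≡∣p∪q∣+∣p∩q∣ (N[_] G v) B ⟩
    ∣ N[_] G v ∪ B ∣ ℕ.+ ∣ N[_] G v ∩ B ∣        ≤⟨ ℕ.+-mono-≤ (∣p∣≤n (N[_] G v ∪ B)) (packing v) ⟩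
    n ℕ.+ k                                      ∎
    where open ℕ.≤-Reasoning

  packing+Δ≤ : ∀ {k B} → 1 ≤ k → IsLimitedPacking G k B →
    ∣ B ∣ ℕ.+ suc (Δ G) ≤ n ℕ.+ k
  packing+Δ≤ {k} {B} 1≤k packing =
    -- A property of the base value and of every listed degree passes to the maximum, so no vertex
    -- attaining `Δ G` has to be chosen. At the base value 0 the bound reads
    -- `∣ B ∣ ℕ.+ 1 ≤ n ℕ.+ k`, which is where `1 ≤ k` enters.
    argmax-all id {P = λ d → ∣ B ∣ ℕ.+ suc d ≤ n ℕ.+ k}
      (ℕ.+-mono-≤ (∣p∣≤n B) 1≤k)
      (map⁺ (All.universal (packing+degree≤ packing) (allFin n)))

  L+Δ≤ : ∀ {k} → 1 ≤ k → L k G ℕ.+ suc (Δ G) ≤ n ℕ.+ k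
  L+Δ≤ {k} 1≤k =
    argmax-all id {P = λ b → b ℕ.+ suc (Δ G) ≤ n ℕ.+ k}
      -- The base value 0 of `L` is covered by the empty packing, whose cardinality is dropped from
      -- the left of the sum.
      (ℕ.m+n≤o⇒n≤o ∣ ∅ {n} ∣ (packing+Δ≤ 1≤k (⊥-isLimitedPacking G k)))
      (map⁺ (All.map (packing+Δ≤ 1≤k) (all-filter (isLimitedPacking? G k) (subsets n))))

theorem3p9 : ∀ (k : ℕ) → 1 ≤ k → ∀ (n : ℕ) → 2 ≤ n → (G : Graph n) →
    + L k G ℤ.≤ + n + + k - + 1 - + Δ G
-- `+ n + + k` computes to `+ (n ℕ.+ k)`, so the bound over `ℕ` transfers directly.
theorem3p9 k 1≤k n 2≤n G = m+[1+n]≤o⇒m≤o-1-n (L+Δ≤ G 1≤k)
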